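{- Let $\mathcal M$ be a monoidal category, let $\mathcal B,\mathcal C,\mathcal E$ be $\mathcal M$-actegories and let $\Gamma:\mathcal C\to\mathcal B$ be a strong $\mathcal M$-equivariant functor. Let $p:\mathcal E\to\mathcal B$ be a fibration that is strict $\mathcal M$-equivariant. Let $\mathcal G$ be the pullback in $\mathbf{Cat}$ of $p$ along $\Gamma$, with projection $q:\mathcal G\to\mathcal C$. Then $\mathcal G$ has an $\mathcal M$-action such that $q:\mathcal G\to\mathcal C$ is strict $\mathcal M$-equivariant.
   Context: Let $(\mathcal M,\otimes,I)$ be a monoidal category. An $\mathcal M$-action on a category $\mathcal C$ is a bifunctor $(-)\cdot(-):\mathcal M\times\mathcal C\to\mathcal C$ with natural isomorphisms $\eta_c:I\cdot c\to c$ and $\mu_{m_1,m_2,c}:(m_1\otimes m_2)\cdot c\to m_1\cdot(m_2\cdot c)$ such that (suppressing associators) $\mu_{m_1,m_2,m_3\cdot c}\circ\mu_{m_1\otimes m_2,m_3,c}=(\mathrm{id}\cdot\mu_{m_2,m_3,c})\circ\mu_{m_1,m_2\otimes m_3,c}$ and $(\mathrm{id}_m\cdot\eta_c)\circ\mu_{m,I,c}=r_m\cdot\mathrm{id}_c$, with $r_m:m\otimes I\to m$ the right unitor. An $\mathcal M$-actegory is a category with an $\mathcal M$-action. A functor $F:\mathcal C\to\mathcal D$ between $\mathcal M$-actegories is lax $\mathcal M$-equivariant if it is equipped with a natural transformation $\phi_{m,c}:m\cdot Fc\to F(m\cdot c)$ such that $F\mu_{m,m',c}\circ\phi_{m\otimes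 m',c}=\phi_{m,m'\cdot c}\circ(\mathrm{id}\cdot\phi_{m',c})\circ\mu_{m,m',Fc}$ and $F\eta_c\circ\phi_{I,c}=\eta_{Fc}$. It is strong if $\phi$ is an isomorphism and strict if $\phi$ is the identity. The pullback $\mathcal G$ has as objects pairs $(C,X)\in\mathcal C\times\mathcal E$ with $\Gamma C=pX$, and as morphisms pairs $(f,x)$ with $\Gamma f=px$; $q(C,X)=C$. -}

module Defs where

open import Level using (Level; _⊔_) renaming (suc to lsuc)
open import Data.Product using (_×_; _,_; proj₁)
open import Relation.Binary.Structures using (IsEquivalence)
open import Relation.Binary.PropositionalEquality using (_≡_; refl; subst₂)

private
  variable
    o ℓ e o′ ℓ′ e′ o″ ℓ″ e″ oᴹ ℓᴹ eᴹ : Level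

-- Hom-sets are setoids, so equality of morphisms is _≈_.  Objects are compared
-- by _≡_; since axiom K holds, proofs of such equalities are unique, and a pair
-- of objects with a proof of an equation between them carries no extra data.
record Category (o ℓ e : Level) : Set (lsuc (o ⊔ ℓ ⊔ e)) where
  infix  4 _≈_ _⇒_ _≈⟨_,_⟩_
  infixr 9 _∘_
  field
    Obj       : Set o
    _⇒_       : Obj → Obj → Set ℓ
    _≈_       : ∀ {A B} → A ⇒ B → A ⇒ B → Set e
    id        : ∀ {A} → A ⇒ A
    _∘_       : ∀ {A B C} → B ⇒ C → A ⇒ B → A ⇒ C
    assoc     : ∀ {A B C D} {f : A ⇒ B} {g : B ⇒ C} {h : C ⇒ D} →
                (h ∘ g) ∘ f ≈ h ∘ (g ∘ f)
    identityˡ : ∀ {A B} {f : A ⇒ B} → id ∘ f ≈ f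
    identityʳ : ∀ {A B} {f : A ⇒ B} → f ∘ id ≈ f
    equiv     : ∀ {A B} → IsEquivalence (_≈_ {A} {B})
    ∘-resp-≈  : ∀ {A B C} {f h : B ⇒ C} {g i : A ⇒ B} →
                f ≈ h → g ≈ i → f ∘ g ≈ h ∘ i

  module Equiv {A B : Obj} = IsEquivalence (equiv {A} {B})

  -- Equality of morphisms whose domains and codomains are only propositionally
  -- equal.
  _≈⟨_,_⟩_ : ∀ {A A′ B B′} → A ⇒ B → A ≡ A′ → B ≡ B′ → A′ ⇒ B′ → Set e
  f ≈⟨ p , q ⟩ g = subst₂ _⇒_ p q f ≈ g

  record IsIso {A B : Obj} (f : A ⇒ B) : Set (ℓ ⊔ e) where
    field
      inv  : B ⇒ A
      isoˡ : inv ∘ f ≈ id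
      isoʳ : f ∘ inv ≈ id

  record IsIdentity {A B : Obj} (f : A ⇒ B) : Set (o ⊔ e) where
    field
      dom≡cod : A ≡ B
      id≈     : id ≈⟨ refl , dom≡cod ⟩ f

  id-cong : ∀ {A A′} (p : A ≡ A′) → id ≈⟨ p , p ⟩ id
  id-cong refl = Equiv.refl

  ∘-cong : ∀ {A A′ B B′ C C′} (p : A ≡ A′) (q : B ≡ B′) (r : C ≡ C′)
           {f : A ⇒ B} {g : B ⇒ C} {f′ : A′ ⇒ B′} {g′ : B′ ⇒ C′} →
           g ≈⟨ q , r ⟩ g′ → f ≈⟨ p , q ⟩ f′ → g ∘ f ≈⟨ p , r ⟩ g′ ∘ f′
  ∘-cong refl refl refl = ∘-resp-≈

  ≈-cong : ∀ {A A′ B B′} (p : A ≡ A′) (q : B ≡ B′) {f f₁ : A ⇒ B} {g g₁ : A′ ⇒ B′} →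
           f₁ ≈ f → g ≈ g₁ → f ≈⟨ p , q ⟩ g → f₁ ≈⟨ p , q ⟩ g₁
  ≈-cong refl refl f₁≈f g≈g₁ f≈g = Equiv.trans f₁≈f (Equiv.trans f≈g g≈g₁)

infixr 2 _×ᶜ_

_×ᶜ_ : Category o ℓ e → Category o′ ℓ′ e′ →
       Category (o ⊔ o′) (ℓ ⊔ ℓ′) (e ⊔ e′)
C ×ᶜ D = record
  { Obj       = C.Obj × D.Obj
  ; _⇒_       = λ { (A , X) (B , Y) → (A C.⇒ B) × (X D.⇒ Y) }
  ; _≈_       = λ { (f , x) (g , y) → (f C.≈ g) × (x D.≈ y) }
  ; id        = C.id , D.id
  ; _∘_       = λ { (g , y) (f , x) → (g C.∘ f) , (y D.∘ x) }
  ; assoc     = C.assoc , D.assoc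
  ; identityˡ = C.identityˡ , D.identityˡ
  ; identityʳ = C.identityʳ , D.identityʳ
  ; equiv     = record
    { refl  = C.Equiv.refl , D.Equiv.refl
    ; sym   = λ { (a , b) → C.Equiv.sym a , D.Equiv.sym b }
    ; trans = λ { (a , b) (c , d) → C.Equiv.trans a c , D.Equiv.trans b d }
    }
  ; ∘-resp-≈  = λ { (a , b) (c , d) → C.∘-resp-≈ a c , D.∘-resp-≈ b d }
  }
  where
  module C = Category C
  module D = Category D

record Functor (C : Category o ℓ e) (D : Category o′ ℓ′ e′) :
               Set (o ⊔ ℓ ⊔ e ⊔ o′ ⊔ ℓ′ ⊔ e′) where
  private
    module C = Category C
    module D = Category D
  field
    F₀           : C.Obj → D.Obj
    F₁           : ∀ {A B} → A C.⇒ B → F₀ A D.⇒ F₀ B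
    identity     : ∀ {A} → F₁ (C.id {A}) D.≈ D.id
    homomorphism : ∀ {X Y Z} {f : X C.⇒ Y} {g : Y C.⇒ Z} →
                   F₁ (g C.∘ f) D.≈ F₁ g D.∘ F₁ f
    F-resp-≈     : ∀ {A B} {f g : A C.⇒ B} → f C.≈ g → F₁ f D.≈ F₁ g

record Monoidal (M : Category o ℓ e) : Set (o ⊔ ℓ ⊔ e) where
  open Category M
  infixr 10 _⊗₀_ _⊗₁_
  field
    ⊗ : Functor (M ×ᶜ M) M
    I : Obj

  _⊗₀_ : Obj → Obj → Obj
  m ⊗₀ n = Functor.F₀ ⊗ (m , n)

  _⊗₁_ : ∀ {m m′ n n′} → m ⇒ m′ → n ⇒ n′ → m ⊗₀ n ⇒ m′ ⊗₀ n′
  f ⊗₁ g = Functor.F₁ ⊗ (f , g)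

  field
    l : ∀ m → I ⊗₀ m ⇒ m
    r : ∀ m → m ⊗₀ I ⇒ m
    α : ∀ m n k → (m ⊗₀ n) ⊗₀ k ⇒ m ⊗₀ (n ⊗₀ k)

    l-natural : ∀ {m m′} (f : m ⇒ m′) → l m′ ∘ (id ⊗₁ f) ≈ f ∘ l m
    r-natural : ∀ {m m′} (f : m ⇒ m′) → r m′ ∘ (f ⊗₁ id) ≈ f ∘ r m
    α-natural : ∀ {m m′ n n′ k k′} (f : m ⇒ m′) (g : n ⇒ n′) (h : k ⇒ k′) →
                α m′ n′ k′ ∘ ((f ⊗₁ g) ⊗₁ h) ≈ (f ⊗₁ (g ⊗₁ h)) ∘ α m n k

    l-iso : ∀ m → IsIso (l m)
    r-iso : ∀ m → IsIso (r m)
    α-iso : ∀ m n k → IsIso (α m n k)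

    triangle : ∀ m n → (id ⊗₁ l n) ∘ α m I n ≈ r m ⊗₁ id
    pentagon : ∀ m n k j →
               (id ⊗₁ α n k j) ∘ α m (n ⊗₀ k) j ∘ (α m n k ⊗₁ id) ≈
               α m n (k ⊗₀ j) ∘ α (m ⊗₀ n) k j

record Action {M : Category oᴹ ℓᴹ eᴹ} (𝓜 : Monoidal M) (C : Category o ℓ e) :
              Set (oᴹ ⊔ ℓᴹ ⊔ eᴹ ⊔ o ⊔ ℓ ⊔ e) where
  private module M = Category M
  open Monoidal 𝓜
  open Category C
  infixr 10 _·₀_ _·₁_
  field
    act : Functor (M ×ᶜ C) C

  _·₀_ : M.Obj → Obj → Obj
  m ·₀ c = Functor.F₀ act (m , c)

  _·₁_ : ∀ {m m′ c c′} → m M.⇒ m′ → c ⇒ c′ → m ·₀ c ⇒ m′ ·₀ c′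
  f ·₁ g = Functor.F₁ act (f , g)

  field
    η : ∀ c → I ·₀ c ⇒ c
    μ : ∀ m n c → (m ⊗₀ n) ·₀ c ⇒ m ·₀ (n ·₀ c)

    η-natural : ∀ {c c′} (h : c ⇒ c′) → η c′ ∘ (M.id ·₁ h) ≈ h ∘ η c
    μ-natural : ∀ {m m′ n n′ c c′} (f : m M.⇒ m′) (g : n M.⇒ n′) (h : c ⇒ c′) →
                μ m′ n′ c′ ∘ ((f ⊗₁ g) ·₁ h) ≈ (f ·₁ (g ·₁ h)) ∘ μ m n c

    η-iso : ∀ c → IsIso (η c)
    μ-iso : ∀ m n c → IsIso (μ m n c)

    μ-assoc : ∀ m₁ m₂ m₃ c →
              μ m₁ m₂ (m₃ ·₀ c) ∘ μ (m₁ ⊗₀ m₂) m₃ c ≈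
              (M.id ·₁ μ m₂ m₃ c) ∘ μ m₁ (m₂ ⊗₀ m₃) c ∘ (α m₁ m₂ m₃ ·₁ id)
    μ-unit  : ∀ m c → (M.id ·₁ η c) ∘ μ m I c ≈ r m ·₁ id

module _ {M : Category oᴹ ℓᴹ eᴹ} {𝓜 : Monoidal M}
         {C : Category o ℓ e} {D : Category o′ ℓ′ e′} where

  record LaxEquivariant (AC : Action 𝓜 C) (AD : Action 𝓜 D) (F : Functor C D) :
                        Set (oᴹ ⊔ ℓᴹ ⊔ o ⊔ ℓ ⊔ ℓ′ ⊔ e′) where
    private
      module M  = Category M
      module C  = Category C
      module AC = Action AC
      module AD = Action AD
    open Monoidal 𝓜
    open Category D
    open Functor F
    field
      φ         : ∀ m c → m AD.·₀ F₀ c ⇒ F₀ (m AC.·₀ c)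
      φ-natural : ∀ {m m′ c c′} (f : m M.⇒ m′) (g : c C.⇒ c′) →
                  φ m′ c′ ∘ (f AD.·₁ F₁ g) ≈ F₁ (f AC.·₁ g) ∘ φ m c
      φ-μ       : ∀ m n c →
                  F₁ (AC.μ m n c) ∘ φ (m ⊗₀ n) c ≈
                  φ m (n AC.·₀ c) ∘ (M.id AD.·₁ φ n c) ∘ AD.μ m n (F₀ c)
      φ-η       : ∀ c → F₁ (AC.η c) ∘ φ I c ≈ AD.η (F₀ c)

  module _ {AC : Action 𝓜 C} {AD : Action 𝓜 D} {F : Functor C D} where

    IsStrong : LaxEquivariant AC AD F → Set (oᴹ ⊔ o ⊔ ℓ′ ⊔ e′)
    IsStrong Φ = ∀ m c → Category.IsIso D (LaxEquivariant.φ Φ m c)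

    IsStrict : LaxEquivariant AC AD F → Set (oᴹ ⊔ o ⊔ o′ ⊔ e′)
    IsStrict Φ = ∀ m c → Category.IsIdentity D (LaxEquivariant.φ Φ m c)

module _ {E : Category o ℓ e} {B : Category o′ ℓ′ e′} (p : Functor E B) where
  private
    module E = Category E
    module B = Category B
  open Functor p

  record IsCartesian {X Y : E.Obj} (f : X E.⇒ Y) : Set (o ⊔ ℓ ⊔ e ⊔ ℓ′ ⊔ e′) where
    field
      factor    : ∀ {Z} (g : Z E.⇒ Y) (w : F₀ Z B.⇒ F₀ X) →
                  F₁ f B.∘ w B.≈ F₁ g → Z E.⇒ X
      factor-p  : ∀ {Z} (g : Z E.⇒ Y) (w : F₀ Z B.⇒ F₀ X) (t : F₁ f B.∘ w B.≈ F₁ g) →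
                  F₁ (factor g w t) B.≈ w
      factor-∘  : ∀ {Z} (g : Z E.⇒ Y) (w : F₀ Z B.⇒ F₀ X) (t : F₁ f B.∘ w B.≈ F₁ g) →
                  f E.∘ factor g w t E.≈ g
      factor-!  : ∀ {Z} (g : Z E.⇒ Y) (w : F₀ Z B.⇒ F₀ X) (t : F₁ f B.∘ w B.≈ F₁ g)
                  (h : Z E.⇒ X) → F₁ h B.≈ w → f E.∘ h E.≈ g → h E.≈ factor g w t

  record CartesianLift (Y : E.Obj) {A : B.Obj} (u : A B.⇒ F₀ Y) :
                       Set (o ⊔ ℓ ⊔ e ⊔ o′ ⊔ ℓ′ ⊔ e′) where
    field
      source    : E.Obj
      over      : F₀ source ≡ A
      lift      : source E.⇒ Y
      lift-over : F₁ lift B.≈⟨ over , refl ⟩ u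
      cartesian : IsCartesian lift

  -- A constructive existence statement provides a choice of lifts.
  IsFibration : Set (o ⊔ ℓ ⊔ e ⊔ o′ ⊔ ℓ′ ⊔ e′)
  IsFibration = ∀ Y {A} (u : A B.⇒ F₀ Y) → CartesianLift Y u

module _ {C : Category o ℓ e} {B : Category o′ ℓ′ e′} {E : Category o″ ℓ″ e″}
         (Γ : Functor C B) (p : Functor E B) where
  private
    module C = Category C
    module B = Category B
    module E = Category E
    module Γ = Functor Γ
    module p = Functor p

  record PullbackObj : Set (o ⊔ o′ ⊔ o″) where
    constructor obj
    field
      fst : C.Obj
      snd : E.Obj
      eq  : Γ.F₀ fst ≡ p.F₀ snd

  record PullbackHom (G H : PullbackObj) : Set (ℓ ⊔ ℓ″ ⊔ e′) where
    constructor hom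
    private
      module G = PullbackObj G
      module H = PullbackObj H
    field
      fst : G.fst C.⇒ H.fst
      snd : G.snd E.⇒ H.snd
      eq  : Γ.F₁ fst B.≈⟨ G.eq , H.eq ⟩ p.F₁ snd

  Pullback : Category (o ⊔ o′ ⊔ o″) (ℓ ⊔ ℓ″ ⊔ e′) (e ⊔ e″)
  Pullback = record
    { Obj       = PullbackObj
    ; _⇒_       = PullbackHom
    ; _≈_       = λ { (hom f x _) (hom g y _) → (f C.≈ g) × (x E.≈ y) }
    ; id        = λ {G} → hom C.id E.id
        (B.≈-cong _ _ Γ.identity (B.Equiv.sym p.identity)
                  (B.id-cong (PullbackObj.eq G)))
    ; _∘_       = λ {G} {H} {K} → λ { (hom g y s) (hom f x t) → hom (g C.∘ f) (y E.∘ x)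
        (B.≈-cong _ _ Γ.homomorphism (B.Equiv.sym p.homomorphism)
                  (B.∘-cong (PullbackObj.eq G) (PullbackObj.eq H) (PullbackObj.eq K) s t)) }
    ; assoc     = C.assoc , E.assoc
    ; identityˡ = C.identityˡ , E.identityˡ
    ; identityʳ = C.identityʳ , E.identityʳ
    ; equiv     = record
      { refl  = C.Equiv.refl , E.Equiv.refl
      ; sym   = λ { (a , b) → C.Equiv.sym a , E.Equiv.sym b }
      ; trans = λ { (a , b) (c , d) → C.Equiv.trans a c , E.Equiv.trans b d }
      }
    ; ∘-resp-≈  = λ { (a , b) (c , d) → C.∘-resp-≈ a c , E.∘-resp-≈ b d }
    }

  Pullback-proj₁ : Functor Pullback C
  Pullback-proj₁ = record
    { F₀           = PullbackObj.fst
    ; F₁           = PullbackHom.fst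
    ; identity     = C.Equiv.refl
    ; homomorphism = C.Equiv.refl
    ; F-resp-≈     = proj₁
    }

{-# OPTIONS --safe #-}
-- Let P be the category of triples (C , X , v) with v : Γ C ≅ p X.  Strength of Γ
-- and p makes P an actegory, acting componentwise, with comparison isomorphism
-- Γ (m · C) ≅ m · Γ C ≅ m · p X ≅ p (m · X).  The pullback is the full subcategory
-- of P on the triples whose v is an identity, and cartesian lifts of isomorphisms
-- are isomorphisms, so each object of P is isomorphic to one of the pullback with
-- the same C.  Transporting the action of P along this equivalence does not change
-- the first component.
module Submission where

open import Defs
open import Level using (Level; _⊔_)
open import Data.Product using (Σ-syntax; _,_; proj₁)
open import Relation.Binary.Bundles using (Setoid)
open import Relation.Binary.PropositionalEquality using (_≡_; refl; sym)
import Relation.Binary.Reasoning.Setoid as SetoidReasoning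

private
  variable
    o ℓ e o′ ℓ′ e′ oᴹ ℓᴹ eᴹ oᴮ ℓᴮ eᴮ oᶜ ℓᶜ eᶜ oᴱ ℓᴱ eᴱ : Level

-- Squares, isomorphisms and equality over object equations in one category.

module Morphisms (C : Category o ℓ e) where
  open Category C

  hom-setoid : Obj → Obj → Setoid ℓ e
  hom-setoid A B = record { isEquivalence = equiv {A} {B} }

  module HomReasoning {A B : Obj} where
    open SetoidReasoning (hom-setoid A B) public

  ∘-respˡ : ∀ {A B D} {f g : B ⇒ D} {h : A ⇒ B} → f ≈ g → f ∘ h ≈ g ∘ h
  ∘-respˡ f≈g = ∘-resp-≈ f≈g Equiv.refl

  ∘-respʳ : ∀ {A B D} {f : B ⇒ D} {g h : A ⇒ B} → g ≈ h → f ∘ g ≈ f ∘ h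
  ∘-respʳ g≈h = ∘-resp-≈ Equiv.refl g≈h

  id-comm : ∀ {A B} {f : A ⇒ B} → f ∘ id ≈ id ∘ f
  id-comm = Equiv.trans identityʳ (Equiv.sym identityˡ)

  paste : ∀ {A A′ B B′ D D′} {h : A ⇒ A′} {k : B ⇒ B′} {l : D ⇒ D′}
          {f : A ⇒ B} {f′ : A′ ⇒ B′} {g : B ⇒ D} {g′ : B′ ⇒ D′} →
          k ∘ f ≈ f′ ∘ h → l ∘ g ≈ g′ ∘ k → l ∘ (g ∘ f) ≈ (g′ ∘ f′) ∘ h
  paste {h = h} {k} {l} {f} {f′} {g} {g′} s t = begin
    l ∘ (g ∘ f)    ≈⟨ assoc ⟨
    (l ∘ g) ∘ f    ≈⟨ ∘-respˡ t ⟩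
    (g′ ∘ k) ∘ f   ≈⟨ assoc ⟩
    g′ ∘ (k ∘ f)   ≈⟨ ∘-respʳ s ⟩
    g′ ∘ (f′ ∘ h)  ≈⟨ assoc ⟨
    (g′ ∘ f′) ∘ h  ∎
    where open HomReasoning

  cancelˡ : ∀ {A B D} {g : B ⇒ D} {h : D ⇒ B} {f : A ⇒ B} → h ∘ g ≈ id → h ∘ (g ∘ f) ≈ f
  cancelˡ hg≈id = Equiv.trans (Equiv.sym assoc) (Equiv.trans (∘-respˡ hg≈id) identityˡ)

  cancelʳ : ∀ {A B D} {g : B ⇒ D} {h : D ⇒ B} {f : B ⇒ A} → h ∘ g ≈ id → (f ∘ h) ∘ g ≈ f
  cancelʳ hg≈id = Equiv.trans assoc (Equiv.trans (∘-respʳ hg≈id) identityʳ)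

  -- Serves to read off the `C`-component of a square whose sides are identities only up to `≈`.
  square-ids : ∀ {A B} {i : A ⇒ A} {j : B ⇒ B} {f g : A ⇒ B} →
               i ≈ id → j ≈ id → f ∘ i ≈ j ∘ g → f ≈ g
  square-ids {i = i} {j} {f} {g} i≈id j≈id s = begin
    f       ≈⟨ identityʳ ⟨
    f ∘ id  ≈⟨ ∘-respʳ i≈id ⟨
    f ∘ i   ≈⟨ s ⟩
    j ∘ g   ≈⟨ ∘-respˡ j≈id ⟩
    id ∘ g  ≈⟨ identityˡ ⟩
    g       ∎
    where open HomReasoning

  id-iso : ∀ {A} → IsIso (id {A})
  id-iso = record { inv = id ; isoˡ = identityˡ ; isoʳ = identityˡ }

  inv-iso : ∀ {A B} {f : A ⇒ B} (i : IsIso f) → IsIso (IsIso.inv i)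
  inv-iso {f = f} i = record { inv = f ; isoˡ = IsIso.isoʳ i ; isoʳ = IsIso.isoˡ i }

  ∘-iso : ∀ {A B D} {g : B ⇒ D} {f : A ⇒ B} → IsIso g → IsIso f → IsIso (g ∘ f)
  ∘-iso i j = record
    { inv  = IsIso.inv j ∘ IsIso.inv i
    ; isoˡ = Equiv.trans assoc (Equiv.trans (∘-respʳ (cancelˡ (IsIso.isoˡ i))) (IsIso.isoˡ j))
    ; isoʳ = Equiv.trans assoc (Equiv.trans (∘-respʳ (cancelˡ (IsIso.isoʳ j))) (IsIso.isoʳ i))
    }

  iso-resp-≈ : ∀ {A B} {f g : A ⇒ B} → f ≈ g → IsIso f → IsIso g
  iso-resp-≈ f≈g i = record
    { inv  = IsIso.inv i
    ; isoˡ = Equiv.trans (∘-respʳ (Equiv.sym f≈g)) (IsIso.isoˡ i)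
    ; isoʳ = Equiv.trans (∘-respˡ (Equiv.sym f≈g)) (IsIso.isoʳ i)
    }

  identity⇒iso : ∀ {A B} {f : A ⇒ B} → IsIdentity f → IsIso f
  identity⇒iso record { dom≡cod = refl ; id≈ = id≈f } = iso-resp-≈ id≈f id-iso

  iso-mono : ∀ {A B D} {j : B ⇒ D} {f g : A ⇒ B} → IsIso j → j ∘ f ≈ j ∘ g → f ≈ g
  iso-mono {j = j} {f} {g} i jf≈jg = begin
    f                        ≈⟨ cancelˡ (IsIso.isoˡ i) ⟨
    IsIso.inv i ∘ (j ∘ f)    ≈⟨ ∘-respʳ jf≈jg ⟩
    IsIso.inv i ∘ (j ∘ g)    ≈⟨ cancelˡ (IsIso.isoˡ i) ⟩
    g                        ∎
    where open HomReasoning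

  square-inv : ∀ {A A′ B B′} {i : A ⇒ B} {j : A′ ⇒ B′} {a : A ⇒ A′} {b : B ⇒ B′}
               (i-iso : IsIso i) (j-iso : IsIso j) → j ∘ a ≈ b ∘ i →
               a ∘ IsIso.inv i-iso ≈ IsIso.inv j-iso ∘ b
  square-inv {i = i} {j} {a} {b} i-iso j-iso s = iso-mono j-iso (begin
    j ∘ (a ∘ i⁻¹)    ≈⟨ assoc ⟨
    (j ∘ a) ∘ i⁻¹    ≈⟨ ∘-respˡ s ⟩
    (b ∘ i) ∘ i⁻¹    ≈⟨ cancelʳ (IsIso.isoʳ i-iso) ⟩
    b                ≈⟨ cancelˡ (IsIso.isoʳ j-iso) ⟨
    j ∘ (j⁻¹ ∘ b)    ∎)
    where
    open HomReasoning
    i⁻¹ = IsIso.inv i-iso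
    j⁻¹ = IsIso.inv j-iso

  -- Object equations become isomorphisms, so that the `subst₂` conditions of the pullback turn into
  -- commuting squares.
  ≡⇒⇒ : ∀ {A B} → A ≡ B → A ⇒ B
  ≡⇒⇒ refl = id

  ≡⇒⇒-iso : ∀ {A B} (p : A ≡ B) → IsIso (≡⇒⇒ p)
  ≡⇒⇒-iso refl = id-iso

  ≈⟨⟩⇒square : ∀ {A A′ B B′} (p : A ≡ A′) (q : B ≡ B′) {f : A ⇒ B} {g : A′ ⇒ B′} →
               f ≈⟨ p , q ⟩ g → g ∘ ≡⇒⇒ p ≈ ≡⇒⇒ q ∘ f
  ≈⟨⟩⇒square refl refl f≈g =
    Equiv.trans id-comm (∘-respʳ (Equiv.sym f≈g))

  square⇒≈⟨⟩ : ∀ {A A′ B B′} (p : A ≡ A′) (q : B ≡ B′) {f : A ⇒ B} {g : A′ ⇒ B′} →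
               g ∘ ≡⇒⇒ p ≈ ≡⇒⇒ q ∘ f → f ≈⟨ p , q ⟩ g
  square⇒≈⟨⟩ refl refl s =
    Equiv.trans (Equiv.sym identityˡ) (Equiv.trans (Equiv.sym s) identityʳ)

  -- A cartesian lift and a pullback object state their object equations in opposite directions,
  -- hence `sym`.
  ≈⟨⟩-sym-∘ : ∀ {A A′ B} (p : A ≡ A′) {f : A ⇒ B} {g : A′ ⇒ B} →
              f ≈⟨ p , refl ⟩ g → f ∘ ≡⇒⇒ (sym p) ≈ g
  ≈⟨⟩-sym-∘ refl f≈g = Equiv.trans identityʳ f≈g

-- Functors and actions applied to squares and isomorphisms.

module FunctorProperties {C : Category o ℓ e} {D : Category o′ ℓ′ e′} (F : Functor C D) where
  private
    module C = Category C
    module D = Category D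
  open Functor F

  F-square : ∀ {W X Y Z} {f : W C.⇒ X} {g : X C.⇒ Z} {h : W C.⇒ Y} {k : Y C.⇒ Z} →
             g C.∘ f C.≈ k C.∘ h → F₁ g D.∘ F₁ f D.≈ F₁ k D.∘ F₁ h
  F-square s = D.Equiv.trans (D.Equiv.sym homomorphism) (D.Equiv.trans (F-resp-≈ s) homomorphism)

  F-retract : ∀ {X Y} {f : X C.⇒ Y} {g : Y C.⇒ X} →
              g C.∘ f C.≈ C.id → F₁ g D.∘ F₁ f D.≈ D.id
  F-retract s = D.Equiv.trans (D.Equiv.sym homomorphism) (D.Equiv.trans (F-resp-≈ s) identity)

  F-iso : ∀ {X Y} {f : X C.⇒ Y} → C.IsIso f → D.IsIso (F₁ f)
  F-iso i = record
    { inv  = F₁ (C.IsIso.inv i)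
    ; isoˡ = F-retract (C.IsIso.isoˡ i)
    ; isoʳ = F-retract (C.IsIso.isoʳ i)
    }

module ActionProperties {M : Category oᴹ ℓᴹ eᴹ} {𝓜 : Monoidal M} {C : Category o ℓ e}
                        (A : Action 𝓜 C) where
  private module M = Category M
  open Category C
  open Monoidal 𝓜
  open Action A
  open Morphisms C

  -- Bifunctoriality, with the given square paired with the trivial square of `f` against
  -- identities.
  ·-square : ∀ {m m′ c c′ d d′} {f : m M.⇒ m′} {i : c ⇒ d} {j : c′ ⇒ d′}
             {u : d ⇒ d′} {a : c ⇒ c′} → u ∘ i ≈ j ∘ a →
             (f ·₁ u) ∘ (M.id ·₁ i) ≈ (M.id ·₁ j) ∘ (f ·₁ a)
  ·-square s = FunctorProperties.F-square act (Morphisms.id-comm M , s)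

  id·-∘ : ∀ {m c d b} {g : d ⇒ b} {f : c ⇒ d} →
          M.id {m} ·₁ (g ∘ f) ≈ (M.id ·₁ g) ∘ (M.id ·₁ f)
  id·-∘ = Equiv.trans (Functor.F-resp-≈ act (M.Equiv.sym M.identityˡ , Equiv.refl))
                      (Functor.homomorphism act)

  id·-iso : ∀ {m c d} {f : c ⇒ d} → IsIso f → IsIso (M.id {m} ·₁ f)
  id·-iso i = record
    { inv  = M.id ·₁ IsIso.inv i
    ; isoˡ = FunctorProperties.F-retract act (M.identityˡ , IsIso.isoˡ i)
    ; isoʳ = FunctorProperties.F-retract act (M.identityˡ , IsIso.isoʳ i)
    }

  id·-id∘id : ∀ {m c} {f : c ⇒ c} → f ≈ id → (M.id {m} ·₁ f) ∘ id ≈ id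
  id·-id∘id f≈id = Equiv.trans identityʳ
    (Equiv.trans (Functor.F-resp-≈ act (M.Equiv.refl , f≈id)) (Functor.identity act))

  μ-naturalʳ : ∀ {m n c c′} (h : c ⇒ c′) →
               μ m n c′ ∘ (M.id ·₁ h) ≈ (M.id ·₁ (M.id ·₁ h)) ∘ μ m n c
  μ-naturalʳ h = Equiv.trans
    (∘-respʳ (Functor.F-resp-≈ act (M.Equiv.sym (Functor.identity ⊗) , Equiv.refl)))
    (μ-natural M.id M.id h)

-- The inverse `g` factors the identity through `f` over the inverse of `p f`. Both `g ∘ f` and `id`
-- factor `f` through itself over the identity, so they agree by uniqueness.
cartesian-over-iso : ∀ {E : Category oᴱ ℓᴱ eᴱ} {B : Category oᴮ ℓᴮ eᴮ} (p : Functor E B)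
  {X Y} {f : Category._⇒_ E X Y} → IsCartesian p f →
  Category.IsIso B (Functor.F₁ p f) → Category.IsIso E f
cartesian-over-iso {E = E} {B} p {f = f} cart i = record
  { inv  = g
  ; isoˡ = Equiv.trans
      (factor-! f B.id B.identityʳ (g ∘ f) pgf≈id
        (Equiv.trans (Equiv.sym assoc) (Equiv.trans (∘-respˡ fg≈id) identityˡ)))
      (Equiv.sym (factor-! f B.id B.identityʳ id identity identityʳ))
  ; isoʳ = fg≈id
  }
  where
  open Category E
  open Morphisms E using (∘-respˡ)
  open Functor p
  open IsCartesian cart
  module B = Category B
  over-id : F₁ f B.∘ B.IsIso.inv i B.≈ F₁ id
  over-id = B.Equiv.trans (B.IsIso.isoʳ i) (B.Equiv.sym identity)
  g = factor id (B.IsIso.inv i) over-id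
  fg≈id : f ∘ g ≈ id
  fg≈id = factor-∘ id (B.IsIso.inv i) over-id
  pgf≈id : F₁ (g ∘ f) B.≈ B.id
  pgf≈id = B.Equiv.trans homomorphism (B.Equiv.trans
    (Morphisms.∘-respˡ B (factor-p id (B.IsIso.inv i) over-id)) (B.IsIso.isoˡ i))

-- Transport of an action along an equivalence.

record FullyFaithful {G : Category o ℓ e} {P : Category o′ ℓ′ e′} (J : Functor G P) :
                     Set (o ⊔ ℓ ⊔ e ⊔ ℓ′ ⊔ e′) where
  private
    module G = Category G
    module P = Category P
  open Functor J
  field
    preimage    : ∀ {A B} → F₀ A P.⇒ F₀ B → A G.⇒ B
    F₁-preimage : ∀ {A B} (u : F₀ A P.⇒ F₀ B) → F₁ (preimage u) P.≈ u
    faithful    : ∀ {A B} {f g : A G.⇒ B} → F₁ f P.≈ F₁ g → f G.≈ g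

-- Chosen data, because the transported action takes its values on objects from `object`.
record EssentialPreimage {G : Category o ℓ e} {P : Category o′ ℓ′ e′} (J : Functor G P)
                         (Q : Category.Obj P) : Set (o ⊔ ℓ′ ⊔ e′) where
  private module P = Category P
  field
    object     : Category.Obj G
    counit     : Functor.F₀ J object P.⇒ Q
    counit-iso : P.IsIso counit

module Transport {M : Category oᴹ ℓᴹ eᴹ} {𝓜 : Monoidal M}
                 {G : Category o ℓ e} {P : Category o′ ℓ′ e′} (AP : Action 𝓜 P)
                 (J : Functor G P) (ff : FullyFaithful J)
                 (eso : ∀ Q → EssentialPreimage J Q) where
  private
    module M  = Category M
    module G  = Category G
    module J  = Functor J
    module AP = Action AP
  open Category P
  open Morphisms P
  open Monoidal 𝓜
  open FullyFaithful ff
  open ActionProperties AP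
  open AP using (_·₀_; _·₁_)

  -- a represents u when the objects A, B of G are identified with P, Q via i, j.
  Square : ∀ {A B P Q} → J.F₀ A ⇒ P → J.F₀ B ⇒ Q → A G.⇒ B → P ⇒ Q → Set e′
  Square i j a u = u ∘ i ≈ j ∘ J.F₁ a

  square-∘ : ∀ {A B D P Q R} {i : J.F₀ A ⇒ P} {j : J.F₀ B ⇒ Q} {k : J.F₀ D ⇒ R} {a b u v} →
             Square j k b v → Square i j a u → Square i k (b G.∘ a) (v ∘ u)
  square-∘ {i = i} {j} {k} {a} {b} {u} {v} t s = begin
    (v ∘ u) ∘ i                ≈⟨ assoc ⟩
    v ∘ (u ∘ i)                ≈⟨ ∘-respʳ s ⟩
    v ∘ (j ∘ J.F₁ a)           ≈⟨ assoc ⟨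
    (v ∘ j) ∘ J.F₁ a           ≈⟨ ∘-respˡ t ⟩
    (k ∘ J.F₁ b) ∘ J.F₁ a      ≈⟨ assoc ⟩
    k ∘ (J.F₁ b ∘ J.F₁ a)      ≈⟨ ∘-respʳ J.homomorphism ⟨
    k ∘ J.F₁ (b G.∘ a)         ∎
    where open HomReasoning

  square-id : ∀ {A P} {i : J.F₀ A ⇒ P} → Square i i G.id id
  square-id = Equiv.trans identityˡ
    (Equiv.sym (Equiv.trans (∘-respʳ J.identity) identityʳ))

  square-F₁ : ∀ {A B} (a : A G.⇒ B) → Square id id a (J.F₁ a)
  square-F₁ a = id-comm

  -- An isomorphism `j` is mono and `J` is faithful. Through this, each equational law of the
  -- transported action follows from the same law in `P`.
  square-unique : ∀ {A B P Q} {i : J.F₀ A ⇒ P} {j : J.F₀ B ⇒ Q} {a b u v} → IsIso j →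
                  Square i j a u → Square i j b v → u ≈ v → a G.≈ b
  square-unique j-iso s t u≈v = faithful (iso-mono j-iso
    (Equiv.trans (Equiv.sym s) (Equiv.trans (∘-respˡ u≈v) t)))

  fill : ∀ {A B P Q} (i : J.F₀ A ⇒ P) {j : J.F₀ B ⇒ Q} → IsIso j → P ⇒ Q → A G.⇒ B
  fill i j-iso u = preimage (IsIso.inv j-iso ∘ (u ∘ i))

  fill-square : ∀ {A B P Q} (i : J.F₀ A ⇒ P) {j : J.F₀ B ⇒ Q} (j-iso : IsIso j) (u : P ⇒ Q) →
                Square i j (fill i j-iso u) u
  fill-square i j-iso u = Equiv.sym
    (Equiv.trans (∘-respʳ (F₁-preimage _)) (cancelˡ (IsIso.isoʳ j-iso)))

  square-iso : ∀ {A B P Q} {i : J.F₀ A ⇒ P} {j : J.F₀ B ⇒ Q} {a u} → IsIso i → IsIso j →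
               Square i j a u → IsIso u → G.IsIso a
  square-iso {i = i} {j} i-iso j-iso s u-iso = record
    { inv  = fill j i-iso u⁻¹
    ; isoˡ = square-unique i-iso (square-∘ t s) square-id (IsIso.isoˡ u-iso)
    ; isoʳ = square-unique j-iso (square-∘ s t) square-id (IsIso.isoʳ u-iso)
    }
    where
    u⁻¹ = IsIso.inv u-iso
    t   = fill-square j i-iso u⁻¹

  infixr 10 _·ᴳ_
  _·ᴳ_ : M.Obj → G.Obj → G.Obj
  m ·ᴳ A = EssentialPreimage.object (eso (m ·₀ J.F₀ A))

  counit : ∀ m A → J.F₀ (m ·ᴳ A) ⇒ m ·₀ J.F₀ A
  counit m A = EssentialPreimage.counit (eso (m ·₀ J.F₀ A))

  -- Admitting any `i`, and not just `id`, allows iteration: `extend m (extend n i)` identifies a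
  -- nested action in `G` with the one in `P`.
  extend : ∀ m {A Q} → J.F₀ A ⇒ Q → J.F₀ (m ·ᴳ A) ⇒ m ·₀ Q
  extend m {A} i = (M.id ·₁ i) ∘ counit m A

  extend-iso : ∀ {m A Q} {i : J.F₀ A ⇒ Q} → IsIso i → IsIso (extend m i)
  extend-iso i-iso = ∘-iso (id·-iso i-iso) (EssentialPreimage.counit-iso (eso _))

  canonical-iso : ∀ {m A} → IsIso (extend m (id {J.F₀ A}))
  canonical-iso = extend-iso id-iso

  -- Two squares are pasted along `u`. This carries a square from canonical identifications to
  -- arbitrary ones.
  square-natural : ∀ {A A′ P P′ Q Q′} {i : J.F₀ A ⇒ P} {j : J.F₀ A′ ⇒ P′} {a u}
                   {h : P ⇒ Q} {k : P′ ⇒ Q′} {v} {i′ : J.F₀ A ⇒ Q} {j′ : J.F₀ A′ ⇒ Q′} →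
                   Square i j a u → v ∘ h ≈ k ∘ u → i′ ≈ h ∘ i → j′ ≈ k ∘ j →
                   Square i′ j′ a v
  square-natural {i = i} {j} {a} {u} {h} {k} {v} {i′} {j′} s n i′≈ j′≈ = begin
    v ∘ i′              ≈⟨ ∘-respʳ i′≈ ⟩
    v ∘ (h ∘ i)         ≈⟨ paste s n ⟩
    (k ∘ j) ∘ J.F₁ a    ≈⟨ ∘-respˡ j′≈ ⟨
    j′ ∘ J.F₁ a         ∎
    where open HomReasoning

  extend-∘ : ∀ {m A P Q} {h : P ⇒ Q} {i : J.F₀ A ⇒ P} {i′ : J.F₀ A ⇒ Q} → i′ ≈ h ∘ i →
             extend m i′ ≈ (M.id ·₁ h) ∘ extend m i
  extend-∘ s = Equiv.trans
    (∘-respˡ (Equiv.trans (Functor.F-resp-≈ AP.act (M.Equiv.refl , s)) id·-∘)) assoc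

  act₁ : ∀ {m m′ A B} → m M.⇒ m′ → A G.⇒ B → m ·ᴳ A G.⇒ m′ ·ᴳ B
  act₁ {m} f a = fill (extend m id) canonical-iso (f ·₁ J.F₁ a)

  -- `act₁` fills the square over `id`; acting on the hypothesis moves that square along `i` and
  -- `j`. `η-square` and `μ-square` do the same by naturality of `η` and `μ`.
  act-square : ∀ {m m′ A B P Q} (f : m M.⇒ m′) {i : J.F₀ A ⇒ P} {j : J.F₀ B ⇒ Q} {a u} →
               Square i j a u → Square (extend m i) (extend m′ j) (act₁ f a) (f ·₁ u)
  act-square f s = square-natural (fill-square _ canonical-iso _) (·-square s)
    (extend-∘ (Equiv.sym identityʳ)) (extend-∘ (Equiv.sym identityʳ))

  ηᴳ : ∀ A → I ·ᴳ A G.⇒ A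
  ηᴳ A = fill (extend I id) id-iso (AP.η (J.F₀ A))

  η-square : ∀ {A P} {i : J.F₀ A ⇒ P} → Square (extend I i) i (ηᴳ A) (AP.η P)
  η-square {i = i} = square-natural (fill-square _ id-iso _) (AP.η-natural i)
    (extend-∘ (Equiv.sym identityʳ)) (Equiv.sym identityʳ)

  μᴳ : ∀ m n A → (m ⊗₀ n) ·ᴳ A G.⇒ m ·ᴳ (n ·ᴳ A)
  μᴳ m n A = fill (extend (m ⊗₀ n) id) (extend-iso canonical-iso) (AP.μ m n (J.F₀ A))

  μ-square : ∀ {m n A P} {i : J.F₀ A ⇒ P} →
             Square (extend (m ⊗₀ n) i) (extend m (extend n i)) (μᴳ m n A) (AP.μ m n P)
  μ-square {i = i} = square-natural (fill-square _ (extend-iso canonical-iso) _) (μ-naturalʳ i)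
    (extend-∘ (Equiv.sym identityʳ)) (extend-∘ (extend-∘ (Equiv.sym identityʳ)))

  actᴳ : Functor (M ×ᶜ G) G
  actᴳ = record
    { F₀           = λ { (m , A) → m ·ᴳ A }
    ; F₁           = λ { (f , a) → act₁ f a }
    ; identity     = square-unique canonical-iso
        (act-square M.id square-id) square-id (Functor.identity AP.act)
    ; homomorphism = λ { {f = f , a} {g = g , b} → square-unique canonical-iso
        -- Here `b ∘ a` represents `J.F₁ b ∘ J.F₁ a`, the form to which bifunctoriality in `P`
        -- applies.
        (act-square (g M.∘ f) (square-∘ (square-F₁ b) (square-F₁ a)))
        (square-∘ (act-square g (square-F₁ b)) (act-square f (square-F₁ a)))
        (Functor.homomorphism AP.act) }
    ; F-resp-≈     = λ { {f = f , a} {g = g , b} (f≈g , a≈b) → square-unique canonical-iso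
        (act-square f (square-F₁ a)) (act-square g (square-F₁ b))
        (Functor.F-resp-≈ AP.act (f≈g , J.F-resp-≈ a≈b)) }
    }

  action : Action 𝓜 G
  action = record
    { act       = actᴳ
    ; η         = ηᴳ
    ; μ         = μᴳ
    ; η-natural = λ h → square-unique id-iso
        (square-∘ η-square (act-square M.id (square-F₁ h)))
        (square-∘ (square-F₁ h) η-square)
        (AP.η-natural (J.F₁ h))
    ; μ-natural = λ f g h → square-unique (extend-iso canonical-iso)
        (square-∘ μ-square (act-square (f ⊗₁ g) (square-F₁ h)))
        (square-∘ (act-square f (act-square g (square-F₁ h))) μ-square)
        (AP.μ-natural f g (J.F₁ h))
    ; η-iso     = λ A → square-iso canonical-iso id-iso η-square (AP.η-iso _)
    ; μ-iso     = λ m n A → square-iso canonical-iso (extend-iso canonical-iso)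
        μ-square (AP.μ-iso m n _)
    -- Three nested actions on the target call for three nested extensions; the associator acts on
    -- the identity square.
    ; μ-assoc   = λ m₁ m₂ m₃ A → square-unique (extend-iso (extend-iso canonical-iso))
        (square-∘ μ-square μ-square)
        (square-∘ (act-square M.id μ-square)
          (square-∘ μ-square (act-square (α m₁ m₂ m₃) square-id)))
        (AP.μ-assoc m₁ m₂ m₃ (J.F₀ A))
    ; μ-unit    = λ m A → square-unique canonical-iso
        (square-∘ (act-square M.id η-square) μ-square)
        (act-square (r m) square-id)
        (AP.μ-unit m (J.F₀ A))
    }

-- The iso-comma category and its equivalence with the pullback.

module _ {C : Category oᶜ ℓᶜ eᶜ} {B : Category oᴮ ℓᴮ eᴮ} {E : Category oᴱ ℓᴱ eᴱ}
         (Γ : Functor C B) (p : Functor E B) where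
  private
    module C = Category C
    module B = Category B
    module E = Category E
    module Γ = Functor Γ
    module p = Functor p
    module ⟦B⟧ = Morphisms B

  record IsoCommaObj : Set (oᶜ ⊔ oᴱ ⊔ ℓᴮ ⊔ eᴮ) where
    field
      fst     : C.Obj
      snd     : E.Obj
      mor     : Γ.F₀ fst B.⇒ p.F₀ snd
      mor-iso : B.IsIso mor

  record IsoCommaHom (P Q : IsoCommaObj) : Set (ℓᶜ ⊔ ℓᴱ ⊔ eᴮ) where
    private
      module P = IsoCommaObj P
      module Q = IsoCommaObj Q
    field
      fst : P.fst C.⇒ Q.fst
      snd : P.snd E.⇒ Q.snd
      eq  : p.F₁ snd B.∘ P.mor B.≈ Q.mor B.∘ Γ.F₁ fst

  open IsoCommaObj
  open IsoCommaHom

  IsoComma : Category (oᶜ ⊔ oᴱ ⊔ ℓᴮ ⊔ eᴮ) (ℓᶜ ⊔ ℓᴱ ⊔ eᴮ) (eᶜ ⊔ eᴱ)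
  IsoComma = record
    { Obj       = IsoCommaObj
    ; _⇒_       = IsoCommaHom
    ; _≈_       = λ h k → Category._≈_ (C ×ᶜ E) (fst h , snd h) (fst k , snd k)
    ; id        = record
      { fst = C.id
      ; snd = E.id
      ; eq  = B.Equiv.trans (⟦B⟧.∘-respˡ p.identity) (B.Equiv.trans
                (B.Equiv.sym ⟦B⟧.id-comm) (⟦B⟧.∘-respʳ (B.Equiv.sym Γ.identity)))
      }
    ; _∘_       = λ k h → record
      { fst = fst k C.∘ fst h
      ; snd = snd k E.∘ snd h
      ; eq  = B.Equiv.trans (⟦B⟧.∘-respˡ p.homomorphism) (B.Equiv.trans
                (B.Equiv.sym (⟦B⟧.paste (B.Equiv.sym (eq h)) (B.Equiv.sym (eq k))))
                (⟦B⟧.∘-respʳ (B.Equiv.sym Γ.homomorphism)))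
      }
    ; assoc     = C.assoc , E.assoc
    ; identityˡ = C.identityˡ , E.identityˡ
    ; identityʳ = C.identityʳ , E.identityʳ
    ; equiv     = record
      { refl  = C.Equiv.refl , E.Equiv.refl
      ; sym   = λ { (a , b) → C.Equiv.sym a , E.Equiv.sym b }
      ; trans = λ { (a , b) (c , d) → C.Equiv.trans a c , E.Equiv.trans b d }
      }
    ; ∘-resp-≈  = λ { (a , b) (c , d) → C.∘-resp-≈ a c , E.∘-resp-≈ b d }
    }

  -- The inverse components are compatible with `mor` because functors preserve inverses and the
  -- square of `h` can be inverted.
  componentwise-iso : ∀ {P Q} (h : IsoCommaHom P Q) → C.IsIso (fst h) → E.IsIso (snd h) →
                      Category.IsIso IsoComma h
  componentwise-iso {P} {Q} h i j = record
    { inv  = record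
      { fst = C.IsIso.inv i
      ; snd = E.IsIso.inv j
      ; eq  = B.Equiv.sym (⟦B⟧.square-inv
                (FunctorProperties.F-iso Γ i) (FunctorProperties.F-iso p j) (eq h))
      }
    ; isoˡ = C.IsIso.isoˡ i , E.IsIso.isoˡ j
    ; isoʳ = C.IsIso.isoʳ i , E.IsIso.isoʳ j
    }

  inclusion : Functor (Pullback Γ p) IsoComma
  inclusion = record
    { F₀           = λ A → record
      { mor     = ⟦B⟧.≡⇒⇒ (PullbackObj.eq A)
      ; mor-iso = ⟦B⟧.≡⇒⇒-iso (PullbackObj.eq A)
      }
    ; F₁           = λ {A} {A′} h → record
      { eq = ⟦B⟧.≈⟨⟩⇒square (PullbackObj.eq A) (PullbackObj.eq A′) (PullbackHom.eq h) }
    ; identity     = C.Equiv.refl , E.Equiv.refl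
    ; homomorphism = C.Equiv.refl , E.Equiv.refl
    ; F-resp-≈     = λ f≈g → f≈g
    }

  inclusion-fullyFaithful : FullyFaithful inclusion
  inclusion-fullyFaithful = record
    { preimage    = λ {A} {A′} h → hom (fst h) (snd h)
        (⟦B⟧.square⇒≈⟨⟩ (PullbackObj.eq A) (PullbackObj.eq A′) (eq h))
    ; F₁-preimage = λ _ → C.Equiv.refl , E.Equiv.refl
    ; faithful    = λ f≈g → f≈g
    }

  -- A cartesian lift of `mor Q` has its source over `Γ C` on the nose. The counit is `id` on the
  -- `C`-component, which later makes the projection strict.
  reindex : IsFibration p → ∀ Q → EssentialPreimage inclusion Q
  reindex fib Q = record
    { object     = obj (fst Q) L.source (sym L.over)
    ; counit     = counit
    ; counit-iso = componentwise-iso counit (Morphisms.id-iso C)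
        -- The image of the lift under `p` is `mor Q` composed with the isomorphism given by
        -- `L.over`.
        (cartesian-over-iso p L.cartesian (⟦B⟧.iso-resp-≈
          (B.Equiv.trans (⟦B⟧.≈⟨⟩⇒square L.over refl L.lift-over) B.identityˡ)
          (⟦B⟧.∘-iso (mor-iso Q) (⟦B⟧.≡⇒⇒-iso L.over))))
    }
    where
    module L = CartesianLift (fib (snd Q) (mor Q))
    counit : IsoCommaHom _ Q
    counit = record
      { fst = C.id
      ; snd = L.lift
      ; eq  = B.Equiv.trans (⟦B⟧.≈⟨⟩-sym-∘ L.over L.lift-over) (B.Equiv.trans
                (B.Equiv.sym B.identityʳ) (⟦B⟧.∘-respʳ (B.Equiv.sym Γ.identity)))
      }

  -- The componentwise action on the iso-comma category.

  module _ {M : Category oᴹ ℓᴹ eᴹ} {𝓜 : Monoidal M}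
           (AB : Action 𝓜 B) (AC : Action 𝓜 C) (AE : Action 𝓜 E)
           (φΓ : LaxEquivariant AC AB Γ) (φΓ-strong : IsStrong φΓ)
           (φp : LaxEquivariant AE AB p) (φp-strong : IsStrong φp) where
    private
      module M  = Category M
      module AB = Action AB
      module AC = Action AC
      module AE = Action AE
      module φΓ = LaxEquivariant φΓ
      module φp = LaxEquivariant φp
    open Monoidal 𝓜
    open B using (_∘_; _≈_)
    open ⟦B⟧
    open ActionProperties AB

    φΓ⁻¹ : ∀ m c → Γ.F₀ (m AC.·₀ c) B.⇒ m AB.·₀ Γ.F₀ c
    φΓ⁻¹ m c = B.IsIso.inv (φΓ-strong m c)

    isoComma-act₀ : M.Obj → IsoCommaObj → IsoCommaObj
    isoComma-act₀ m P = record
      { fst     = m AC.·₀ fst P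
      ; snd     = m AE.·₀ snd P
      ; mor     = φp.φ m (snd P) ∘ ((M.id AB.·₁ mor P) ∘ φΓ⁻¹ m (fst P))
      ; mor-iso = ∘-iso (φp-strong _ _)
                    (∘-iso (id·-iso (mor-iso P)) (inv-iso (φΓ-strong _ _)))
      }

    isoComma-act₁ : ∀ {m m′ P Q} → m M.⇒ m′ → IsoCommaHom P Q →
                    IsoCommaHom (isoComma-act₀ m P) (isoComma-act₀ m′ Q)
    isoComma-act₁ f h = record
      { fst = f AC.·₁ fst h
      ; snd = f AE.·₁ snd h
      -- Three squares: naturality of `φΓ⁻¹`, the action on the square of `h`, naturality of `φp`.
      ; eq  = paste
          (paste (square-inv (φΓ-strong _ _) (φΓ-strong _ _) (φΓ.φ-natural f (fst h)))
                 (·-square (eq h)))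
          (B.Equiv.sym (φp.φ-natural f (snd h)))
      }

    -- The unit laws of `φp` and `φΓ` are joined by naturality of `η` at `v`.
    isoComma-η : ∀ P → IsoCommaHom (isoComma-act₀ I P) P
    isoComma-η P = record
      { fst = AC.η (fst P)
      ; snd = AE.η (snd P)
      ; eq  = begin
          p.F₁ (AE.η x) ∘ (φp.φ I x ∘ ((M.id AB.·₁ v) ∘ φΓ⁻¹ I c))  ≈⟨ B.assoc ⟨
          (p.F₁ (AE.η x) ∘ φp.φ I x) ∘ ((M.id AB.·₁ v) ∘ φΓ⁻¹ I c)  ≈⟨ ∘-respˡ (φp.φ-η x) ⟩
          AB.η (p.F₀ x) ∘ ((M.id AB.·₁ v) ∘ φΓ⁻¹ I c)               ≈⟨ B.assoc ⟨
          (AB.η (p.F₀ x) ∘ (M.id AB.·₁ v)) ∘ φΓ⁻¹ I c               ≈⟨ ∘-respˡ (AB.η-natural v) ⟩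
          (v ∘ AB.η (Γ.F₀ c)) ∘ φΓ⁻¹ I c                            ≈⟨ B.assoc ⟩
          v ∘ (AB.η (Γ.F₀ c) ∘ φΓ⁻¹ I c)                            ≈⟨ ∘-respʳ (∘-respˡ (φΓ.φ-η c)) ⟨
          v ∘ ((Γ.F₁ (AC.η c) ∘ φΓ.φ I c) ∘ φΓ⁻¹ I c)               ≈⟨ ∘-respʳ cancel ⟩
          v ∘ Γ.F₁ (AC.η c)                                         ∎
      }
      where
      open HomReasoning
      c = fst P
      x = snd P
      v = mor P
      cancel : (Γ.F₁ (AC.η c) ∘ φΓ.φ I c) ∘ φΓ⁻¹ I c ≈ Γ.F₁ (AC.η c)
      cancel = cancelʳ (B.IsIso.isoʳ (φΓ-strong I c))

    isoComma-μ : ∀ m n P →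
      IsoCommaHom (isoComma-act₀ (m ⊗₀ n) P) (isoComma-act₀ m (isoComma-act₀ n P))
    isoComma-μ m n P = record
      { fst = AC.μ m n c
      ; snd = AE.μ m n x
      ; eq  = B.Equiv.trans
          -- Three squares: the `φ-μ` law of `φΓ` inverted, naturality of `μ` at `v`, and the `φ-μ`
          -- law of `φp`.
          (paste
            (paste
              (square-inv (φΓ-strong _ _) (∘-iso (φΓ-strong _ _) (id·-iso (φΓ-strong n c)))
                (B.Equiv.trans B.assoc (B.Equiv.sym (φΓ.φ-μ m n c))))
              (μ-naturalʳ v))
            (B.Equiv.trans (φp.φ-μ m n x) (B.Equiv.sym B.assoc)))
          (∘-respˡ (B.Equiv.trans B.assoc (∘-respʳ reassociate)))
      }
      where
      c = fst P
      x = snd P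
      v = mor P
      -- Pasting leaves the inner comparison as separate factors under `m`; functoriality of the
      -- action collects them into the `mor` of the twice-acted object.
      reassociate :
        (M.id AB.·₁ φp.φ n x) ∘
          ((M.id AB.·₁ (M.id AB.·₁ v)) ∘ ((M.id AB.·₁ φΓ⁻¹ n c) ∘ φΓ⁻¹ m (n AC.·₀ c))) ≈
        (M.id AB.·₁ (φp.φ n x ∘ ((M.id AB.·₁ v) ∘ φΓ⁻¹ n c))) ∘ φΓ⁻¹ m (n AC.·₀ c)
      reassociate = B.Equiv.sym (B.Equiv.trans
        (∘-respˡ (B.Equiv.trans id·-∘ (∘-respʳ id·-∘)))
        (B.Equiv.trans B.assoc (∘-respʳ B.assoc)))

    isoComma-action : Action 𝓜 IsoComma
    isoComma-action = record
      { act       = record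
        { F₀           = λ { (m , P) → isoComma-act₀ m P }
        ; F₁           = λ { (f , h) → isoComma-act₁ f h }
        ; identity     = Functor.identity AC.act , Functor.identity AE.act
        ; homomorphism = Functor.homomorphism AC.act , Functor.homomorphism AE.act
        ; F-resp-≈     = λ { (s , (t , u)) →
            Functor.F-resp-≈ AC.act (s , t) , Functor.F-resp-≈ AE.act (s , u) }
        }
      ; η         = isoComma-η
      ; μ         = isoComma-μ
      ; η-natural = λ h → AC.η-natural (fst h) , AE.η-natural (snd h)
      ; μ-natural = λ f g h → AC.μ-natural f g (fst h) , AE.μ-natural f g (snd h)
      ; η-iso     = λ P → componentwise-iso (isoComma-η P) (AC.η-iso _) (AE.η-iso _)
      ; μ-iso     = λ m n P →
          componentwise-iso (isoComma-μ m n P) (AC.μ-iso m n _) (AE.μ-iso m n _)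
      ; μ-assoc   = λ m₁ m₂ m₃ P →
          AC.μ-assoc m₁ m₂ m₃ (fst P) , AE.μ-assoc m₁ m₂ m₃ (snd P)
      ; μ-unit    = λ m P → AC.μ-unit m (fst P) , AE.μ-unit m (snd P)
      }

    -- Strict equivariance of the projection.

    module _ (fib : IsFibration p) where
      private
        module T = Transport isoComma-action inclusion inclusion-fullyFaithful (reindex fib)
        module ⟦C⟧ = Morphisms C
        module ·ᶜ = ActionProperties AC

        idᴾ : ∀ {A} → IsoCommaHom (Functor.F₀ inclusion A) (Functor.F₀ inclusion A)
        idᴾ {A} = Category.id IsoComma {Functor.F₀ inclusion A}

      -- The left side is the `C`-component of `T.extend m id`, since the counit of `reindex` is
      -- `id` there.
      extend-id : ∀ {m c} → (M.id {m} AC.·₁ C.id {c}) C.∘ C.id C.≈ C.id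
      extend-id = ·ᶜ.id·-id∘id C.Equiv.refl

      -- Each axiom is the `C`-component of the square defining the transported structure, once its
      -- identity sides are removed.
      projection-equivariant : LaxEquivariant T.action AC (Pullback-proj₁ Γ p)
      projection-equivariant = record
        { φ         = λ _ _ → C.id
        ; φ-natural = λ {_} {_} {A} {A′} f g → C.Equiv.trans C.identityˡ (C.Equiv.trans
            (⟦C⟧.square-ids extend-id extend-id
              (proj₁ (T.act-square {A = A} {A′} f {idᴾ {A}} {idᴾ {A′}}
                {a = g} {Functor.F₁ inclusion g} (T.square-F₁ {A} {A′} g))))
            (C.Equiv.sym C.identityʳ))
        ; φ-μ       = λ m n A → C.Equiv.trans C.identityʳ (C.Equiv.sym
            (C.Equiv.trans C.identityˡ (C.Equiv.trans
              (⟦C⟧.∘-respˡ (Functor.identity AC.act))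
              (C.Equiv.trans C.identityˡ
                -- The target side is a twice extended identity, so the collapse is applied twice.
                (⟦C⟧.square-ids extend-id (·ᶜ.id·-id∘id extend-id)
                  (proj₁ (T.μ-square {m} {n} {A} {i = idᴾ {A}})))))))
        ; φ-η       = λ A → C.Equiv.trans C.identityʳ (C.Equiv.sym
            (⟦C⟧.square-ids extend-id C.Equiv.refl (proj₁ (T.η-square {A} {i = idᴾ {A}}))))
        }

proposition23 : ∀ {oᴹ ℓᴹ eᴹ oᴮ ℓᴮ eᴮ oᶜ ℓᶜ eᶜ oᴱ ℓᴱ eᴱ : Level}
    {M : Category oᴹ ℓᴹ eᴹ} (𝓜 : Monoidal M)
    {B : Category oᴮ ℓᴮ eᴮ} {C : Category oᶜ ℓᶜ eᶜ} {E : Category oᴱ ℓᴱ eᴱ}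
    (AB : Action 𝓜 B) (AC : Action 𝓜 C) (AE : Action 𝓜 E)
    (Γ : Functor C B) (φΓ : LaxEquivariant AC AB Γ) → IsStrong φΓ →
    (p : Functor E B) → IsFibration p →
    (φp : LaxEquivariant AE AB p) → IsStrict φp →
    Σ[ AG ∈ Action 𝓜 (Pullback Γ p) ]
    Σ[ φq ∈ LaxEquivariant AG AC (Pullback-proj₁ Γ p) ] IsStrict φq
proposition23 𝓜 {B} {C} AB AC AE Γ φΓ φΓ-strong p fib φp φp-strict =
  T.action , projection-equivariant Γ p AB AC AE φΓ φΓ-strong φp φp-strong fib ,
  -- `reindex` keeps the `C`-component, so both objects are `m · C` by computation.
  λ _ _ → record { dom≡cod = refl ; id≈ = Category.Equiv.refl C }
  where
  φp-strong : IsStrong φp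
  φp-strong m x = Morphisms.identity⇒iso B (φp-strict m x)
  module T = Transport (isoComma-action Γ p AB AC AE φΓ φΓ-strong φp φp-strong)
    (inclusion Γ p) (inclusion-fullyFaithful Γ p) (reindex Γ p fib)
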